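{- Let $A$ be a countable structure and let $v\in\{\omega_1^A,\omega_1^A+1\}$. Then $$\mathrm{SR}^{\mathrm{AK}}(A)=v\iff\mathrm{SR}^{\sim}(A)=v .$$ Moreover $\mathrm{SR}^{\mathrm{AK}}(A)\ge\omega_1^A\iff\mathrm{SR}^{\sim}(A)\ge\omega_1^A$.
   Context: Structures are countable structures in a countable vocabulary. $\omega_1^A=\min\{\omega_1^X:X\in2^\omega\text{ computes a copy of }A\}$. All tuples are finite tuples of $A$, and relations compare tuples of equal length. $\mathrm{SR}^{\sim}$: $\bar a\sim_0\bar b$ iff they have the same atomic type; $\bar a\sim_{\alpha+1}\bar b$ iff for every $c\in A$ there is $d\in A$ with $\bar ac\sim_\alpha\bar bd$ and for every $d\in A$ there is $c\in A$ with $\bar ac\sim_\alpha\bar bd$ (one-element extensions); at limits $\lambda$, $\bar a\sim_\lambda\bar b$ iff $\bar a\sim_\beta\bar b$ for all $\beta<\lambda$. $\rho^{\sim}(\bar a)$ is the least $\alpha$ such that every $\bar b$ with $\bar a\sim_\alpha\bar b$ is automorphic to $\bar a$ in $A$. $\mathrm{SR}^{\sim}(A)=\sup\{\rho^{\sim}(\bar a)+1:\bar a\in A^{<\omega}\}$. $\mathrm{SR}^{\mathrm{AK}}$ (Ash–Knight symmetric rank): $\bar a\sim^{\mathrm{AK}}_0\bar b$ iff they satisfy the same open (finitary quantifier-free) formulas; for $\beta>0$, $\bar a\sim^{\mathrm{AK}}_\beta\bar b$ iff for every $\gamma<\beta$: for every finite tuple $\bar c$ there is $\bar d$ with $\bar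 a\bar c\sim^{\mathrm{AK}}_\gamma\bar b\bar d$, and for every finite tuple $\bar d$ there is $\bar c$ with $\bar a\bar c\sim^{\mathrm{AK}}_\gamma\bar b\bar d$. $\rho^{\mathrm{AK}}(\bar a)$ is the least $\beta$ such that every $\bar b$ with $\bar a\sim^{\mathrm{AK}}_\beta\bar b$ satisfies the same $L_{\omega_1\omega}$ formulas as $\bar a$. $\mathrm{SR}^{\mathrm{AK}}(A)=\sup\{\rho^{\mathrm{AK}}(\bar a)+1:\bar a\in A^{<\omega}\}$. -}

module Defs where

open import Data.Bool using (Bool; T; if_then_else_)
open import Data.Fin using (Fin)
open import Data.Nat as ℕ using (ℕ)
open import Data.Product using (Σ; ∃; ∃-syntax; _×_; _,_)
open import Data.Sum using (_⊎_)
open import Data.Unit using (⊤)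
open import Data.Empty using (⊥)
open import Data.Vec using (Vec; []; _∷_; _++_; map; lookup)
open import Data.Vec.Relation.Binary.Pointwise.Inductive using (Pointwise)
open import Function.Bundles using (_⇔_; _↣_; _↔_; Injection; Inverse)
open import Induction.WellFounded using (Acc; acc; WellFounded)
open import Relation.Binary.PropositionalEquality using (_≡_)
open import Relation.Nullary using (¬_)

------------------------------------------------------------------------
-- Countable ordinals

infix 4 _≤_ _<_ _≈_
infixl 6 _+1

-- Brouwer trees.  Limits are taken of strictly increasing sequences only, so
-- that 𝟎, _+1 and lim really are the three cases zero, successor, limit.
-- Classically every countable ordinal is denoted by such a tree, in general by
-- many: equality of ordinals is _≈_, not _≡_.
data Ord : Set
data _≤_ : Ord → Ord → Set

data Ord where
  𝟎   : Ord
  _+1 : Ord → Ord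
  lim : (f : ℕ → Ord) → (∀ k → f k +1 ≤ f (ℕ.suc k)) → Ord

data _≤_ where
  𝟎≤   : ∀ {α} → 𝟎 ≤ α
  +1≤  : ∀ {α β} → α ≤ β → α +1 ≤ β +1
  ≤lim : ∀ {α f f↑} k → α ≤ f k → α ≤ lim f f↑
  lim≤ : ∀ {α f f↑} → (∀ k → f k ≤ α) → lim f f↑ ≤ α

_<_ _≈_ : Ord → Ord → Set
α < β = α +1 ≤ β
α ≈ β = α ≤ β × β ≤ α

≤-refl : ∀ {α} → α ≤ α
≤-refl {𝟎}        = 𝟎≤
≤-refl {α +1}     = +1≤ ≤-refl
≤-refl {lim f f↑} = lim≤ λ k → ≤lim k ≤-refl

≤-trans : ∀ {α β γ} → α ≤ β → β ≤ γ → α ≤ γ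
≤-trans 𝟎≤         _          = 𝟎≤
≤-trans (lim≤ p)   q          = lim≤ λ k → ≤-trans (p k) q
≤-trans (+1≤ p)    (+1≤ q)    = +1≤ (≤-trans p q)
≤-trans (+1≤ p)    (≤lim k q) = ≤lim k (≤-trans (+1≤ p) q)
≤-trans (≤lim k p) (lim≤ q)   = ≤-trans p (q k)
≤-trans (≤lim k p) (≤lim l q) = ≤lim l (≤-trans (≤lim k p) q)

<-wellFounded : WellFounded _<_
<-wellFounded α = acc (below α)
  where
  below : ∀ α {β} → β < α → Acc _<_ β
  below (α +1)     (+1≤ β≤α)    = acc λ γ<β → below α (≤-trans γ<β β≤α)
  below (lim f f↑) (≤lim k β<fk) = below (f k) β<fk

IsLeast : (Ord → Set) → Ord → Set
IsLeast P α = P α × (∀ β → P β → α ≤ β)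

IsSup : (Ord → Set) → Ord → Set
IsSup P = IsLeast λ σ → ∀ α → P α → α ≤ σ

------------------------------------------------------------------------
-- Computability relative to an oracle

-- n-ary partial recursive functions with an oracle.
data Code : ℕ → Set where
  zero   : ∀ {n} → Code n
  succ   : Code 1
  oracle : Code 1
  proj   : ∀ {n} → Fin n → Code n
  comp   : ∀ {m n} → Code m → Vec (Code n) m → Code n
  prec   : ∀ {n} → Code n → Code (2 ℕ.+ n) → Code (1 ℕ.+ n)
  mu     : ∀ {n} → Code (1 ℕ.+ n) → Code n

module _ (X : ℕ → Bool) where

  infix 4 _[_]⇓_

  data _[_]⇓_ : ∀ {n} → Code n → Vec ℕ n → ℕ → Set where
    zero⇓   : ∀ {n} {xs : Vec ℕ n} → zero [ xs ]⇓ 0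
    succ⇓   : ∀ {x} → succ [ x ∷ [] ]⇓ ℕ.suc x
    oracle⇓ : ∀ {x} → oracle [ x ∷ [] ]⇓ (if X x then 1 else 0)
    proj⇓   : ∀ {n} {xs : Vec ℕ n} {i} → proj i [ xs ]⇓ lookup xs i
    comp⇓   : ∀ {m n} {f : Code m} {gs : Vec (Code n) m} {xs ys z} →
              Pointwise (λ g y → g [ xs ]⇓ y) gs ys → f [ ys ]⇓ z →
              comp f gs [ xs ]⇓ z
    prec⇓₀  : ∀ {n} {f : Code n} {g xs y} →
              f [ xs ]⇓ y → prec f g [ 0 ∷ xs ]⇓ y
    prec⇓₊  : ∀ {n} {f : Code n} {g xs k r y} →
              prec f g [ k ∷ xs ]⇓ r → g [ k ∷ r ∷ xs ]⇓ y →
              prec f g [ ℕ.suc k ∷ xs ]⇓ y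
    mu⇓     : ∀ {n} {f : Code (1 ℕ.+ n)} {xs k} →
              f [ k ∷ xs ]⇓ 0 →
              (∀ j → j ℕ.< k → ∃[ r ] f [ j ∷ xs ]⇓ ℕ.suc r) →
              mu f [ xs ]⇓ k

  Computable : ∀ n → (Vec ℕ n → Set) → Set
  Computable n P = Σ (Code n) λ c → ∀ xs →
    (P xs → c [ xs ]⇓ 1) × (¬ P xs → c [ xs ]⇓ 0)

-- α is the order type of _≺_ restricted to D (values of rank off D are junk).
record HasOrderType (D : ℕ → Bool) (_≺_ : ℕ → ℕ → Bool) (α : Ord) : Set where
  field
    rank       : ℕ → Ord
    bounded    : ∀ {x} → T (D x) → rank x < α
    order      : ∀ {x y} → T (D x) → T (D y) → T (x ≺ y) ⇔ rank x < rank y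
    injective  : ∀ {x y} → T (D x) → T (D y) → rank x ≈ rank y → x ≡ y
    surjective : ∀ β → β < α → ∃[ x ] T (D x) × rank x ≈ β

-- α is the order type of an X-computable well-ordering of a subset of ω.
ComputableOrdinal : (ℕ → Bool) → Ord → Set
ComputableOrdinal X α =
  Σ (ℕ → Bool) λ D → Σ (ℕ → ℕ → Bool) λ _≺_ →
    Computable X 1 (λ { (x ∷ []) → T (D x) }) ×
    Computable X 2 (λ { (x ∷ y ∷ []) → T (x ≺ y) }) ×
    HasOrderType D _≺_ α

-- κ = ω₁^X
IsOmega₁-oracle : (ℕ → Bool) → Ord → Set
IsOmega₁-oracle X = IsLeast λ α → ¬ ComputableOrdinal X α

------------------------------------------------------------------------
-- Countable vocabularies and structures

-- Constants are function symbols of arity 0.  The injections into ℕ are the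
-- Gödel numbering with respect to which atomic diagrams are coded.
record Vocabulary : Set₁ where
  field
    RelSym   : Set
    FunSym   : Set
    relArity : RelSym → ℕ
    funArity : FunSym → ℕ
    relCode  : RelSym ↣ ℕ
    funCode  : FunSym ↣ ℕ

record Structure (L : Vocabulary) : Set₁ where
  open Vocabulary L
  field
    Carrier   : Set
    countable : Carrier ↣ ℕ
    rel       : (R : RelSym) → Vec Carrier (relArity R) → Set
    fun       : (f : FunSym) → Vec Carrier (funArity f) → Carrier

-- Injective on finite sequences: n, m ↦ 2ⁿ(1 + 2m) is injective with values > 0.
encode : ∀ {n} → Vec ℕ n → ℕ
encode []       = 0
encode (x ∷ xs) = 2 ℕ.^ x ℕ.* (1 ℕ.+ 2 ℕ.* encode xs)

module _ {L : Vocabulary} (A : Structure L) where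
  open Vocabulary L
  open Structure A

  -- A copy with universe a subset of ω is the transport of A along an
  -- injection ν into ℕ; X computes it if it computes the universe and,
  -- uniformly in the symbol, the relations and the graphs of the functions.
  record ComputesCopy (X : ℕ → Bool) : Set where
    field
      embedding : Carrier ↣ ℕ
    open Injection embedding using () renaming (to to ν)
    field
      universe  : Computable X 1 λ { (x ∷ []) → ∃[ a ] x ≡ ν a }
      relations : Computable X 2 λ { (r ∷ e ∷ []) →
        ∃[ R ] Σ (Vec Carrier (relArity R)) λ as →
          r ≡ Injection.to relCode R × e ≡ encode (map ν as) × rel R as }
      functions : Computable X 3 λ { (r ∷ e ∷ y ∷ []) →
        ∃[ f ] Σ (Vec Carrier (funArity f)) λ as →
          r ≡ Injection.to funCode f × e ≡ encode (map ν as) × y ≡ ν (fun f as) }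

  -- κ = ω₁^A
  IsOmega₁ : Ord → Set
  IsOmega₁ = IsLeast λ α → ∃[ X ] ComputesCopy X × IsOmega₁-oracle X α

  record Automorphism : Set where
    field
      bijection : Carrier ↔ Carrier
    open Inverse bijection public using (to)
    field
      preserves-rel : ∀ R as → rel R as ⇔ rel R (map to as)
      preserves-fun : ∀ f as → to (fun f as) ≡ fun f (map to as)

------------------------------------------------------------------------
-- Formulas with free variables among the n entries of a tuple

module _ (L : Vocabulary) where
  open Vocabulary L

  data Term (n : ℕ) : Set where
    var : Fin n → Term n
    app : (f : FunSym) → Vec (Term n) (funArity f) → Term n

  data Atomic (n : ℕ) : Set where
    _≐_ : Term n → Term n → Atomic n
    rel : (R : RelSym) → Vec (Term n) (relArity R) → Atomic n

  data Open (n : ℕ) : Set where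
    atom    : Atomic n → Open n
    ⊤′ ⊥′   : Open n
    ¬′_     : Open n → Open n
    _∧′_ _∨′_ : Open n → Open n → Open n

  -- L_{ω₁ω}.  Nonempty countable conjunctions and disjunctions are indexed by
  -- ℕ, with repetitions if finite; the empty ones are ⊤′ and ⊥′.
  data Infinitary : ℕ → Set where
    atom  : ∀ {n} → Atomic n → Infinitary n
    ⊤′ ⊥′ : ∀ {n} → Infinitary n
    ¬′_   : ∀ {n} → Infinitary n → Infinitary n
    ⋀ ⋁   : ∀ {n} → (ℕ → Infinitary n) → Infinitary n
    ∀′ ∃′ : ∀ {n} → Infinitary (1 ℕ.+ n) → Infinitary n

module _ {L : Vocabulary} (A : Structure L) where
  open Structure A

  eval  : ∀ {n} → Vec Carrier n → Term L n → Carrier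
  evals : ∀ {n k} → Vec Carrier n → Vec (Term L n) k → Vec Carrier k
  eval a (var i)    = lookup a i
  eval a (app f ts) = fun f (evals a ts)
  evals a []        = []
  evals a (t ∷ ts)  = eval a t ∷ evals a ts

  SatAtomic : ∀ {n} → Atomic L n → Vec Carrier n → Set
  SatAtomic (s ≐ t)    a = eval a s ≡ eval a t
  SatAtomic (rel R ts) a = Structure.rel A R (evals a ts)

  SatOpen : ∀ {n} → Open L n → Vec Carrier n → Set
  SatOpen (atom φ) a = SatAtomic φ a
  SatOpen ⊤′       a = ⊤
  SatOpen ⊥′       a = ⊥
  SatOpen (¬′ φ)   a = ¬ SatOpen φ a
  SatOpen (φ ∧′ ψ) a = SatOpen φ a × SatOpen ψ a
  SatOpen (φ ∨′ ψ) a = SatOpen φ a ⊎ SatOpen ψ a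

  Sat : ∀ {n} → Infinitary L n → Vec Carrier n → Set
  Sat (atom φ) a = SatAtomic φ a
  Sat ⊤′       a = ⊤
  Sat ⊥′       a = ⊥
  Sat (¬′ φ)   a = ¬ Sat φ a
  Sat (⋀ φ)    a = ∀ i → Sat (φ i) a
  Sat (⋁ φ)    a = ∃[ i ] Sat (φ i) a
  Sat (∀′ φ)   a = ∀ x → Sat φ (x ∷ a)
  Sat (∃′ φ)   a = ∃[ x ] Sat φ (x ∷ a)

------------------------------------------------------------------------
-- Back-and-forth relations and ranks

  TupleRel : Set₁
  TupleRel = ∀ {n} → Vec Carrier n → Vec Carrier n → Set

  SameAtomicType SameOpenFormulas SameInfinitaryFormulas Automorphic : TupleRel
  SameAtomicType         {n} a b = (φ : Atomic L n) → SatAtomic φ a ⇔ SatAtomic φ b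
  SameOpenFormulas       {n} a b = (φ : Open L n) → SatOpen φ a ⇔ SatOpen φ b
  SameInfinitaryFormulas {n} a b = (φ : Infinitary L n) → Sat φ a ⇔ Sat φ b
  Automorphic            {n} a b = Σ (Automorphism A) λ g → map (Automorphism.to g) a ≡ b

  -- Tuples grow at the head of the vector: the extension of a by c is written
  -- c ∷ a, respectively c ++ a.
  BackForth₁ BackForth : TupleRel → TupleRel
  BackForth₁ E a b =
    (∀ c → ∃[ d ] E (c ∷ a) (d ∷ b)) ×
    (∀ d → ∃[ c ] E (c ∷ a) (d ∷ b))
  BackForth E a b =
    (∀ {m} (c : Vec Carrier m) → Σ (Vec Carrier m) λ d → E (c ++ a) (d ++ b)) ×
    (∀ {m} (d : Vec Carrier m) → Σ (Vec Carrier m) λ c → E (c ++ a) (d ++ b))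

  sim : ∀ α → Acc _<_ α → TupleRel
  sim 𝟎          _        a b = SameAtomicType a b
  sim (α +1)     (acc rs) a b = BackForth₁ (sim α (rs ≤-refl)) a b
  sim (lim f f↑) (acc rs) a b = ∀ β (β<λ : β < lim f f↑) → sim β (rs β<λ) a b

  simAK  : ∀ β → Acc _<_ β → TupleRel
  simAK₊ : ∀ β → Acc _<_ β → TupleRel
  simAK 𝟎           _ a b = SameOpenFormulas a b
  simAK β@(_ +1)    p a b = simAK₊ β p a b
  simAK β@(lim _ _) p a b = simAK₊ β p a b
  simAK₊ β (acc rs) a b = ∀ γ (γ<β : γ < β) → BackForth (simAK γ (rs γ<β)) a b

  Sim SimAK : Ord → TupleRel
  Sim   α = sim α (<-wellFounded α)
  SimAK α = simAK α (<-wellFounded α)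

  IsRank : (E : Ord → TupleRel) (T : TupleRel) → ∀ {n} → Vec Carrier n → Ord → Set
  IsRank E T a = IsLeast λ α → ∀ b → E α a b → T a b

  IsSupRank : (E : Ord → TupleRel) (T : TupleRel) → Ord → Set
  IsSupRank E T = IsSup λ α →
    ∃[ n ] Σ (Vec Carrier n) λ a → ∃[ ρ ] IsRank E T a ρ × α ≡ ρ +1

  -- SR^∼(A) = σ and SR^AK(A) = σ
  IsSR∼ IsSRAK : Ord → Set
  IsSR∼  σ = IsSupRank Sim Automorphic σ
  IsSRAK σ = IsSupRank SimAK SameInfinitaryFormulas σ

{-# OPTIONS --safe #-}

-- m one-element extensions realise one extension by an m-tuple, so ∼ at ω·β
-- refines ∼^AK at β, which in turn refines ∼ at β.  Tuples satisfying the same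
-- infinitary formulas are automorphic (Scott), so both ranks concern the same
-- relation and ρ^AK ≤ ρ^∼ ≤ ω·ρ^AK.  It remains to see that κ = ω₁^X is closed
-- under α ↦ ω·α: the X-computable ordinals are closed downwards, under
-- successor, and under α ↦ ω·α.

module Submission where

open import Axiom.ExcludedMiddle using (ExcludedMiddle)
open import Data.Bool using (Bool; true; false; T; if_then_else_)
open import Data.Empty using (⊥; ⊥-elim)
open import Data.Fin as Fin using (Fin)
open import Data.Nat as ℕ using (ℕ; _∸_)
import Data.Nat.Properties as ℕₚ
open import Data.Product using (Σ; _×_; _,_; proj₁; proj₂; ∃-syntax)
open import Data.Sum using (_⊎_; inj₁; inj₂)
open import Data.Maybe.Base using (Maybe; just; nothing; maybe)
open import Data.Vec using (Vec; []; _∷_; _++_; map; lookup; tabulate)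
open import Data.Vec.Properties using (lookup-map; tabulate∘lookup; tabulate-cong; ∷-injective)
open import Data.Vec.Relation.Binary.Pointwise.Inductive using ([]; _∷_)
open import Function.Base using (_∘_; id)
open import Function.Bundles using (_⇔_; mk⇔; mk↔ₛ′; Equivalence; Injection; Inverse)
open import Function.Construct.Composition using (_⇔-∘_)
open import Function.Construct.Symmetry using (⇔-sym)
open import Induction.WellFounded using (Acc; acc)
open import Level using (0ℓ)
open import Relation.Binary.Definitions using (tri<; tri≈; tri>)
open import Relation.Binary.PropositionalEquality
  using (_≡_; _≢_; refl; sym; trans; cong; cong₂; subst; subst₂; module ≡-Reasoning)
open import Relation.Nullary using (¬_; yes; no)
open import Defs

-- Ordinals

-- The factor `ω` cannot be replaced by a finite one: an Ash-Knight step answers a tuple whose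
-- length is chosen only after the level, so a single step has to leave room for every finite number
-- of one-element steps. The two comparisons are asymmetric. A strict bound on the ∼-ranks bounds
-- the Ash-Knight ranks unchanged, whereas the converse costs a factor `ω`. The delicate value is
-- `v = κ +1`, since `ω* (κ +1)` exceeds `κ +1`. What is multiplied, however, is not `v` but the
-- ranks below it. These are at most `κ`, and `ω* κ ≤ κ` because `κ` is closed under successor and
-- hence not a successor itself. Ranks and suprema are relations here, so each comparison also has
-- to produce the rank or supremum on the other side; excluded middle supplies it as a least
-- ordinal.

≤+1 : ∀ α → α ≤ α +1
≤+1 𝟎          = 𝟎≤
≤+1 (α +1)     = +1≤ (≤+1 α)
≤+1 (lim f f↑) = lim≤ λ k → ≤-trans (≤+1 (f k)) (+1≤ (≤lim k ≤-refl))

<⇒≤ : ∀ {α β} → α < β → α ≤ β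
<⇒≤ {α} p = ≤-trans (≤+1 α) p

<-irrefl : ∀ {α} → ¬ α < α
<-irrefl {α} p = go (<-wellFounded α)
  where
  go : Acc _<_ α → ⊥
  go (acc rs) = go (rs p)

≤⇒≯ : ∀ {α β} → α ≤ β → ¬ β < α
≤⇒≯ p q = <-irrefl (≤-trans q p)

infixl 6 _+ᶠ_
_+ᶠ_ : Ord → ℕ → Ord
α +ᶠ ℕ.zero  = α
α +ᶠ ℕ.suc n = (α +ᶠ n) +1

+1-+ᶠ : ∀ α n → (α +1) +ᶠ n ≡ α +ᶠ ℕ.suc n
+1-+ᶠ α ℕ.zero    = refl
+1-+ᶠ α (ℕ.suc n) = cong _+1 (+1-+ᶠ α n)

+ᶠ-monoˡ : ∀ {α β} n → α ≤ β → α +ᶠ n ≤ β +ᶠ n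
+ᶠ-monoˡ ℕ.zero    p = p
+ᶠ-monoˡ (ℕ.suc n) p = +1≤ (+ᶠ-monoˡ n p)

≤+ᶠ : ∀ α n → α ≤ α +ᶠ n
≤+ᶠ α ℕ.zero    = ≤-refl
≤+ᶠ α (ℕ.suc n) = ≤-trans (≤+ᶠ α n) (≤+1 _)

+ᶠ-monoʳ : ∀ α {m n} → m ℕ.≤ n → α +ᶠ m ≤ α +ᶠ n
+ᶠ-monoʳ α {n = n} ℕ.z≤n = ≤+ᶠ α n
+ᶠ-monoʳ α (ℕ.s≤s p)     = +1≤ (+ᶠ-monoʳ α p)

mutual
  -- This is the product with `α` copies of `ω`, the last copy on top. A limit carries a proof that
  -- its sequence is strictly increasing, which forces the simultaneous proof of monotonicity.
  ω*_ : Ord → Ord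
  ω* 𝟎        = 𝟎
  ω* (α +1)   = lim (λ n → ω* α +ᶠ n) λ _ → ≤-refl
  ω* lim f f↑ = lim (λ k → ω* f k) λ k →
    ≤-trans (≤lim 1 ≤-refl) (ω*-mono (f↑ k))

  ω*-mono : ∀ {α β} → α ≤ β → ω* α ≤ ω* β
  ω*-mono 𝟎≤         = 𝟎≤
  ω*-mono (+1≤ p)    = lim≤ λ n → ≤lim n (+ᶠ-monoˡ n (ω*-mono p))
  ω*-mono (≤lim k p) = ≤lim k (ω*-mono p)
  ω*-mono (lim≤ p)   = lim≤ λ k → ω*-mono (p k)

infix 9 ω*_

-- Term `suc n` of the sequence for `ω* (γ +1)` already lies above. The same `α` serves every `n`,
-- so tuples of all lengths fit.
ω*+ᶠ<ω* : ∀ {γ α} n → γ < α → ω* γ +ᶠ n < ω* α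
ω*+ᶠ<ω* n p = ≤-trans (≤lim (ℕ.suc n) ≤-refl) (ω*-mono p)

-- Oracle computations

bit : Bool → ℕ
bit b = if b then 1 else 0

cond : ℕ → ℕ → ℕ → ℕ
cond ℕ.zero    x y = y
cond (ℕ.suc _) x y = x

-- Round `k` subtracts `suc k` exactly when the current residue exceeds `k`. A single accumulator
-- suffices, so this is one primitive recursion without coded pairs.
residue : ℕ → ℕ → ℕ
residue ℕ.zero    z = z
residue (ℕ.suc k) z = cond (residue k z ∸ k) (residue k z ∸ ℕ.suc k) (residue k z)

-- The triangular numbers are subtracted from z one summand at a time, as long
-- as possible: fibre (k(k+1)/2 + x) = x for x ≤ k.
fibre : ℕ → ℕ
fibre z = residue z z

module _ (X : ℕ → Bool) where

  Computes : ∀ n → (Vec ℕ n → ℕ) → Set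
  Computes n f = Σ (Code n) λ c → ∀ xs → _[_]⇓_ X c xs (f xs)

  -- Boolean predicates become total functions with values 0 and 1, so that decision procedures
  -- compose like any other codes.
  Decides : ∀ n → (Vec ℕ n → Bool) → Set
  Decides n b = Computes n (bit ∘ b)

  bit⇓ : ∀ {n} {c : Code n} {xs} b →
         (T b → _[_]⇓_ X c xs 1) × (¬ T b → _[_]⇓_ X c xs 0) → _[_]⇓_ X c xs (bit b)
  bit⇓ true  h = proj₁ h _
  bit⇓ false h = proj₂ h id

  bit⇓⁻¹ : ∀ {n} {c : Code n} {xs} b → _[_]⇓_ X c xs (bit b) →
           (T b → _[_]⇓_ X c xs 1) × (¬ T b → _[_]⇓_ X c xs 0)
  bit⇓⁻¹ true  h = (λ _ → h) , λ ¬t → ⊥-elim (¬t _)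
  bit⇓⁻¹ false h = (λ ()) , λ _ → h

  ComputableOrder : (ℕ → Bool) → (ℕ → ℕ → Bool) → Set
  ComputableOrder D _≺_ =
    Decides 1 (λ xs → D (lookup xs Fin.zero)) ×
    Decides 2 (λ xs → lookup xs Fin.zero ≺ lookup xs (Fin.suc Fin.zero))

  computableOrdinal : ∀ {D _≺_ α} →
    ComputableOrder D _≺_ → HasOrderType D _≺_ α → ComputableOrdinal X α
  computableOrdinal {D} {_≺_} ((c , c⇓) , (d , d⇓)) o = D , _≺_ ,
    (c , λ { (x ∷ []) → bit⇓⁻¹ (D x) (c⇓ (x ∷ [])) }) ,
    (d , λ { (x ∷ y ∷ []) → bit⇓⁻¹ (x ≺ y) (d⇓ (x ∷ y ∷ [])) }) , o

  computableOrder : ∀ {α} (o : ComputableOrdinal X α) → ComputableOrder (proj₁ o) (proj₁ (proj₂ o))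
  computableOrder (D , _≺_ , (c , c⇓) , (d , d⇓) , o) =
    (c , λ { (x ∷ []) → bit⇓ (D x) (c⇓ (x ∷ [])) }) ,
    (d , λ { (x ∷ y ∷ []) → bit⇓ (x ≺ y) (d⇓ (x ∷ y ∷ [])) })

  argument : ∀ {n} (i : Fin n) → Computes n (λ xs → lookup xs i)
  argument i = proj i , λ xs → proj⇓

  const : ∀ {n} k → Computes n (λ _ → k)
  const ℕ.zero    = zero , λ xs → zero⇓
  const (ℕ.suc k) = let c , c⇓ = const k in
    comp succ (c ∷ []) , λ xs → comp⇓ (c⇓ xs ∷ []) succ⇓

  comp₁ : ∀ {n F f} → Computes 1 F → Computes n f → Computes n (λ xs → F (f xs ∷ []))
  comp₁ (C , C⇓) (c , c⇓) =
    comp C (c ∷ []) , λ xs → comp⇓ (c⇓ xs ∷ []) (C⇓ _)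

  comp₂ : ∀ {n F f g} → Computes 2 F → Computes n f → Computes n g →
          Computes n (λ xs → F (f xs ∷ g xs ∷ []))
  comp₂ (C , C⇓) (c , c⇓) (d , d⇓) =
    comp C (c ∷ d ∷ []) , λ xs → comp⇓ (c⇓ xs ∷ d⇓ xs ∷ []) (C⇓ _)

  pred-computes : ∀ {n f} → Computes n f → Computes n (λ xs → ℕ.pred (f xs))
  pred-computes = comp₁ {F = λ xs → ℕ.pred (lookup xs Fin.zero)} (c , λ { (x ∷ []) → c⇓ x })
    where
    c = prec zero (proj Fin.zero)
    c⇓ : ∀ x → _[_]⇓_ X c (x ∷ []) (ℕ.pred x)
    c⇓ ℕ.zero    = prec⇓₀ zero⇓
    c⇓ (ℕ.suc x) = prec⇓₊ (c⇓ x) proj⇓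

  ∸-computes : ∀ {n f g} → Computes n f → Computes n g → Computes n (λ xs → f xs ∸ g xs)
  -- Primitive recursion runs on the first argument, so the subtrahend comes first.
  ∸-computes f g = comp₂ {F = λ xs → lookup xs (Fin.suc Fin.zero) ∸ lookup xs Fin.zero}
    (c , λ { (k ∷ x ∷ []) → c⇓ k x }) g f
    where
    p = pred-computes (argument {3} (Fin.suc Fin.zero))
    c = prec (proj Fin.zero) (proj₁ p)
    c⇓ : ∀ k x → _[_]⇓_ X c (k ∷ x ∷ []) (x ∸ k)
    c⇓ ℕ.zero    x = prec⇓₀ proj⇓
    c⇓ (ℕ.suc k) x = subst (_[_]⇓_ X c _) (ℕₚ.pred[m∸n]≡m∸[1+n] x k)
      (prec⇓₊ (c⇓ k x) (proj₂ p (k ∷ (x ∸ k) ∷ x ∷ [])))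

  cond-computes : ∀ {n f g h} → Computes n f → Computes n g → Computes n h →
                  Computes n (λ xs → cond (f xs) (g xs) (h xs))
  cond-computes (f , f⇓) (g , g⇓) (h , h⇓) =
    comp c (f ∷ g ∷ h ∷ []) , λ xs → comp⇓ (f⇓ xs ∷ g⇓ xs ∷ h⇓ xs ∷ []) (c⇓ _ _ _)
    where
    -- Case distinction as a recursion that ignores its recursive value: the base picks `y`, the
    -- step picks `x`.
    c = prec (proj (Fin.suc Fin.zero)) (proj (Fin.suc (Fin.suc Fin.zero)))
    c⇓ : ∀ k x y → _[_]⇓_ X c (k ∷ x ∷ y ∷ []) (cond k x y)
    c⇓ ℕ.zero    x y = prec⇓₀ proj⇓
    c⇓ (ℕ.suc k) x y = prec⇓₊ (c⇓ k x y) proj⇓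

  fibre-computes : ∀ {n f} → Computes n f → Computes n (λ xs → fibre (f xs))
  fibre-computes f = comp₂ {F = λ xs → residue (lookup xs Fin.zero) (lookup xs (Fin.suc Fin.zero))}
    (c , λ { (k ∷ z ∷ []) → c⇓ k z }) f f
    where
    k′ = argument {3} Fin.zero
    r′ = argument {3} (Fin.suc Fin.zero)
    step = cond-computes (∸-computes r′ k′) (pred-computes (∸-computes r′ k′)) r′
    c = prec (proj Fin.zero) (proj₁ step)
    c⇓ : ∀ k z → _[_]⇓_ X c (k ∷ z ∷ []) (residue k z)
    c⇓ ℕ.zero    z = prec⇓₀ proj⇓
    c⇓ (ℕ.suc k) z = subst
      (λ x → _[_]⇓_ X c (ℕ.suc k ∷ z ∷ []) (cond (residue k z ∸ k) x (residue k z)))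
      (ℕₚ.pred[m∸n]≡m∸[1+n] (residue k z) k)
      (prec⇓₊ (c⇓ k z) (proj₂ step (k ∷ residue k z ∷ z ∷ [])))

  if-decides : ∀ {n b c d} → Decides n b → Decides n c → Decides n d →
               Decides n (λ xs → if b xs then c xs else d xs)
  if-decides {b = b} {c} {d} B C D =
    let e , e⇓ = cond-computes B C D in
    e , λ xs → subst (_[_]⇓_ X e xs) (cond-bit (b xs) (c xs) (d xs)) (e⇓ xs)
    where
    cond-bit : ∀ b c d → cond (bit b) (bit c) (bit d) ≡ bit (if b then c else d)
    cond-bit true  c d = refl
    cond-bit false c d = refl

  0<-decides : ∀ {n f} → Computes n f → Decides n (λ xs → 0 ℕ.<ᵇ f xs)
  0<-decides {f = f} F =
    let e , e⇓ = cond-computes F (const 1) (const 0) in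
    e , λ xs → subst (_[_]⇓_ X e xs) (cond-bit (f xs)) (e⇓ xs)
    where
    cond-bit : ∀ k → cond k 1 0 ≡ bit (0 ℕ.<ᵇ k)
    cond-bit ℕ.zero    = refl
    cond-bit (ℕ.suc k) = refl

-- Every fibre of `fibre` is a copy of ω.

count : ℕ → ℕ → ℕ
count x ℕ.zero    = 0
count x (ℕ.suc z) with fibre z ℕ.≟ x
... | yes _ = ℕ.suc (count x z)
... | no _  = count x z

-- It occurs in ranks only and needs no code: inside a fibre the order compares the numbers
-- themselves, which agrees with comparing positions.
position : ℕ → ℕ
position z = count (fibre z) z

count-suc : ∀ {x} z → fibre z ≡ x → count x (ℕ.suc z) ≡ ℕ.suc (count x z)
count-suc {x} z p with fibre z ℕ.≟ x
... | yes _ = refl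
... | no ¬p = ⊥-elim (¬p p)

count-step : ∀ x z → count x z ℕ.≤ count x (ℕ.suc z)
count-step x z with fibre z ℕ.≟ x
... | yes _ = ℕₚ.n≤1+n _
... | no _  = ℕₚ.≤-refl

count-mono : ∀ x {z w} → z ℕ.≤′ w → count x z ℕ.≤ count x w
count-mono x ℕ.≤′-refl = ℕₚ.≤-refl
count-mono x (ℕ.≤′-step {w} p) = ℕₚ.≤-trans (count-mono x p) (count-step x w)

position-mono : ∀ z w → fibre z ≡ fibre w → z ℕ.< w → position z ℕ.< position w
position-mono z w p z<w = subst (λ x → position z ℕ.< count x w) p
  (subst (ℕ._≤ count (fibre z) w) (count-suc z refl)
    (count-mono (fibre z) (ℕₚ.≤⇒≤′ z<w)))

triangle : ℕ → ℕ
triangle ℕ.zero    = 0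
triangle (ℕ.suc k) = triangle k ℕ.+ ℕ.suc k

n≤triangle : ∀ n → n ℕ.≤ triangle n
n≤triangle ℕ.zero    = ℕ.z≤n
n≤triangle (ℕ.suc n) = ℕₚ.m≤n+m (ℕ.suc n) (triangle n)

-- No bound on `x` is imposed, because the induction uses the case `k` at `suc k + x`.
residue-triangle : ∀ k x → residue k (triangle k ℕ.+ x) ≡ x
residue-triangle ℕ.zero    x = refl
residue-triangle (ℕ.suc k) x
  rewrite ℕₚ.+-assoc (triangle k) (ℕ.suc k) x
        | residue-triangle k (ℕ.suc k ℕ.+ x)
        | sym (ℕₚ.+-suc k x)
        | ℕₚ.m+n∸m≡n k (ℕ.suc x)
  = ℕₚ.m+n∸m≡n k x

residue-stable : ∀ {k l z x} → k ℕ.≤′ l → residue k z ≡ x → x ℕ.≤ k → residue l z ≡ x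
residue-stable ℕ.≤′-refl p _ = p
residue-stable (ℕ.≤′-step {l} k≤l) p x≤k
  rewrite residue-stable k≤l p x≤k
        | ℕₚ.m≤n⇒m∸n≡0 (ℕₚ.≤-trans x≤k (ℕₚ.≤′⇒≤ k≤l)) = refl

-- After `k` rounds only `x ≤ k` is left, and all later tests fail. The number of rounds,
-- `triangle k + x`, is at least `k`.
fibre-triangle : ∀ {k x} → x ℕ.≤ k → fibre (triangle k ℕ.+ x) ≡ x
fibre-triangle {k} {x} = residue-stable
  (ℕₚ.≤⇒≤′ (ℕₚ.≤-trans (n≤triangle k) (ℕₚ.m≤m+n (triangle k) x)))
  (residue-triangle k x)

count-unbounded : ∀ x n → ∃[ z ] n ℕ.≤ count x z
count-unbounded x ℕ.zero    = 0 , ℕ.z≤n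
count-unbounded x (ℕ.suc n) with count-unbounded x n
... | z , n≤ = ℕ.suc w , subst (ℕ.suc n ℕ.≤_) (sym (count-suc w w∈))
                (ℕ.s≤s (ℕₚ.≤-trans n≤ (count-mono x (ℕₚ.≤⇒≤′ z≤w))))
  where
  -- `x ≤ k` puts `w` into the fibre of `x`, and `z ≤ k` puts it at or beyond `z`.
  k = x ℕ.+ z
  w = triangle k ℕ.+ x
  w∈ : fibre w ≡ x
  w∈ = fibre-triangle (ℕₚ.m≤m+n x z)
  z≤w : z ℕ.≤ w
  z≤w = ℕₚ.≤-trans (ℕₚ.m≤n+m z x) (ℕₚ.≤-trans (n≤triangle k) (ℕₚ.m≤m+n (triangle k) x))

-- The count grows without bound in steps of at most one, so a downward search from a large count
-- meets the step from `n` to `suc n`; that step is taken at the witness.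
position-surjective : ∀ x n → ∃[ z ] fibre z ≡ x × position z ≡ n
position-surjective x n = let z , p = count-unbounded x (ℕ.suc n) in go z p
  where
  go : ∀ z → n ℕ.< count x z → ∃[ z ] fibre z ≡ x × position z ≡ n
  go (ℕ.suc z) p with fibre z ℕ.≟ x
  ... | no _ = go z p
  ... | yes refl with ℕₚ.m<1+n⇒m<n∨m≡n p
  ...   | inj₁ q = go z q
  ...   | inj₂ q = z , refl , sym q

0<ᵇ∸⇒< : ∀ {m n} → T (0 ℕ.<ᵇ (n ∸ m)) → m ℕ.< n
0<ᵇ∸⇒< {m} {n} p = ℕₚ.m∸n≢0⇒n<m λ eq → subst (λ k → T (0 ℕ.<ᵇ k)) eq p

<⇒0<ᵇ∸ : ∀ {m n} → m ℕ.< n → T (0 ℕ.<ᵇ (n ∸ m))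
<⇒0<ᵇ∸ p = ℕₚ.<⇒<ᵇ (ℕₚ.m<n⇒0<n∸m p)

-- Comparison of the back-and-forth relations

module _ {L : Vocabulary} (A : Structure L) where
  open Structure A using (Carrier)

  SameAtomicType-sym : ∀ {n} {a b : Vec Carrier n} → SameAtomicType A a b → SameAtomicType A b a
  SameAtomicType-sym h φ = mk⇔ (Equivalence.from (h φ)) (Equivalence.to (h φ))

  SatOpen-resp : ∀ {n} {a b : Vec Carrier n} → SameAtomicType A a b →
                 ∀ φ → SatOpen A φ a → SatOpen A φ b
  SatOpen-resp h (atom φ) s        = Equivalence.to (h φ) s
  SatOpen-resp h ⊤′       s        = s
  SatOpen-resp h (¬′ φ)   s        = s ∘ SatOpen-resp (SameAtomicType-sym h) φ
  SatOpen-resp h (φ ∧′ ψ) (s , t)  = SatOpen-resp h φ s , SatOpen-resp h ψ t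
  SatOpen-resp h (φ ∨′ ψ) (inj₁ s) = inj₁ (SatOpen-resp h φ s)
  SatOpen-resp h (φ ∨′ ψ) (inj₂ s) = inj₂ (SatOpen-resp h ψ s)

  BackForth-map : ∀ {E F : TupleRel A} →
    (∀ {n} (a b : Vec Carrier n) → E a b → F a b) →
    ∀ {n} {a b : Vec Carrier n} → BackForth A E a b → BackForth A F a b
  BackForth-map h (f , g) =
    (λ c → let d , e = f c in d , h _ _ e) , (λ d → let c , e = g d in c , h _ _ e)

  -- The relations recurse on accessibility proofs, and different descents to one ordinal yield
  -- different proofs; this transfers between them.
  sim-irrelevant : ∀ α (p q : Acc _<_ α) {n} {a b : Vec Carrier n} → sim A α p a b → sim A α q a b
  sim-irrelevant 𝟎 _ _ h = h
  sim-irrelevant (α +1) (acc rs) (acc rs′) (f , g) =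
    (λ c → let d , e = f c in d , sim-irrelevant α (rs ≤-refl) (rs′ ≤-refl) e) ,
    (λ d → let c , e = g d in c , sim-irrelevant α (rs ≤-refl) (rs′ ≤-refl) e)
  sim-irrelevant (lim f f↑) (acc rs) (acc rs′) h β β<λ =
    sim-irrelevant β (rs β<λ) (rs′ β<λ) (h β β<λ)

  simAK-irrelevant : ∀ β (p q : Acc _<_ β) {n} (a b : Vec Carrier n) →
                     simAK A β p a b → simAK A β q a b
  simAK-irrelevant 𝟎 _ _ _ _ h = h
  simAK-irrelevant (_ +1) (acc rs) (acc rs′) _ _ h γ γ<β =
    BackForth-map (simAK-irrelevant γ (rs γ<β) (rs′ γ<β)) (h γ γ<β)
  simAK-irrelevant (lim _ _) (acc rs) (acc rs′) _ _ h γ γ<β =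
    BackForth-map (simAK-irrelevant γ (rs γ<β) (rs′ γ<β)) (h γ γ<β)

  -- Above `𝟎` the clauses for `β` are among those for `α`; at `𝟎` the empty extension returns the
  -- tuples themselves. The limit case of `simAK⇒sim` needs this descent, since there ∼ refers to
  -- lower levels without extending the tuples.
  simAK₊⇒simAK : ∀ {α β} (p : Acc _<_ α) (q : Acc _<_ β) → β < α → ∀ {n} {a b : Vec Carrier n} →
                 simAK₊ A α p a b → simAK A β q a b
  simAK₊⇒simAK {β = 𝟎} (acc rs) q β<α h with proj₁ (h 𝟎 β<α) []
  ... | [] , e = e
  simAK₊⇒simAK {β = β +1} (acc rs) (acc rs′) β<α h γ γ<β =
    BackForth-map (simAK-irrelevant γ (rs (≤-trans γ<β (<⇒≤ β<α))) (rs′ γ<β)) (h γ _)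
  simAK₊⇒simAK {β = lim f f↑} (acc rs) (acc rs′) β<α h γ γ<β =
    BackForth-map (simAK-irrelevant γ (rs (≤-trans γ<β (<⇒≤ β<α))) (rs′ γ<β)) (h γ _)

  simAK⇒sim : ∀ α (p q : Acc _<_ α) {n} (a b : Vec Carrier n) → simAK A α p a b → sim A α q a b
  simAK⇒sim 𝟎 _ _ _ _ h φ = h (atom φ)
  simAK⇒sim (α +1) (acc rs) (acc rs′) a b h = forth , back
    where
    bf = BackForth-map (simAK⇒sim α (rs ≤-refl) (rs′ ≤-refl)) (h α ≤-refl)
    forth : ∀ c → ∃[ d ] sim A α (rs′ ≤-refl) (c ∷ a) (d ∷ b)
    forth c with proj₁ bf (c ∷ [])
    ... | d ∷ [] , e = d , e
    back : ∀ d → ∃[ c ] sim A α (rs′ ≤-refl) (c ∷ a) (d ∷ b)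
    back d with proj₂ bf (d ∷ [])
    ... | c ∷ [] , e = c , e
  simAK⇒sim (lim f f↑) p@(acc rs) (acc rs′) a b h β β<λ =
    simAK⇒sim β (rs β<λ) (rs′ β<λ) a b (simAK₊⇒simAK p (rs β<λ) β<λ h)

  Sim-+1 : ∀ α {n} {a b : Vec Carrier n} → Sim A (α +1) a b → BackForth₁ A (Sim A α) a b
  Sim-+1 α (f , g) =
    (λ c → let d , e = f c in d , sim-irrelevant α _ _ e) ,
    (λ d → let c , e = g d in c , sim-irrelevant α _ _ e)

  Sim-lim : ∀ {f f↑} {n} {a b : Vec Carrier n} →
            Sim A (lim f f↑) a b → ∀ β → β < lim f f↑ → Sim A β a b
  Sim-lim h β β<λ = sim-irrelevant β _ _ (h β β<λ)

  -- Tuples grow at the head, so in `x ∷ c` the entry `x` is added last. The induction therefore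
  -- treats `c` over `α +1` and keeps the bottom step for `x`.
  Sim-+ᶠ : ∀ α m {n} {a b : Vec Carrier n} → Sim A (α +ᶠ m) a b →
    (∀ (c : Vec Carrier m) → Σ (Vec Carrier m) λ d → Sim A α (c ++ a) (d ++ b)) ×
    (∀ (d : Vec Carrier m) → Σ (Vec Carrier m) λ c → Sim A α (c ++ a) (d ++ b))
  Sim-+ᶠ α ℕ.zero h = (λ { [] → [] , h }) , (λ { [] → [] , h })
  Sim-+ᶠ α (ℕ.suc m) {a = a} {b} h = forth , back
    where
    bf = Sim-+ᶠ (α +1) m (subst (λ β → Sim A β a b) (sym (+1-+ᶠ α m)) h)
    forth : ∀ (c : Vec Carrier (ℕ.suc m)) → Σ (Vec Carrier (ℕ.suc m)) λ d → Sim A α (c ++ a) (d ++ b)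
    forth (x ∷ c) = let d , e = proj₁ bf c
                        y , e′ = proj₁ (Sim-+1 α e) x
                    in y ∷ d , e′
    back : ∀ (d : Vec Carrier (ℕ.suc m)) → Σ (Vec Carrier (ℕ.suc m)) λ c → Sim A α (c ++ a) (d ++ b)
    back (y ∷ d) = let c , e = proj₂ bf d
                       x , e′ = proj₂ (Sim-+1 α e) y
                   in x ∷ c , e′

  -- `ω* β` unfolds to a limit once `β` is known to be a successor or a limit; `γ < β` excludes `𝟎`.
  Sim-ω*-lower : ∀ {γ} β m → γ < β → ∀ {n} {a b : Vec Carrier n} →
                 Sim A (ω* β) a b → Sim A (ω* γ +ᶠ m) a b
  Sim-ω*-lower (β +1)     m γ<β h = Sim-lim h _ (ω*+ᶠ<ω* m γ<β)
  Sim-ω*-lower (lim f f↑) m γ<β h = Sim-lim h _ (ω*+ᶠ<ω* m γ<β)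

  mutual
    Sim-ω*⇒simAK : ∀ β (p : Acc _<_ β) {n} {a b : Vec Carrier n} →
                   Sim A (ω* β) a b → simAK A β p a b
    Sim-ω*⇒simAK 𝟎 _ h φ = mk⇔ (SatOpen-resp h φ) (SatOpen-resp (SameAtomicType-sym h) φ)
    Sim-ω*⇒simAK (β +1)     p h = Sim-ω*⇒simAK₊ p h
    Sim-ω*⇒simAK (lim f f↑) p h = Sim-ω*⇒simAK₊ p h

    Sim-ω*⇒simAK₊ : ∀ {β} (p : Acc _<_ β) {n} {a b : Vec Carrier n} →
                    Sim A (ω* β) a b → simAK₊ A β p a b
    Sim-ω*⇒simAK₊ {β} (acc rs) h γ γ<β =
      (λ {m} c → let d , e = proj₁ (Sim-+ᶠ (ω* γ) m (Sim-ω*-lower β m γ<β h)) c in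
                 d , Sim-ω*⇒simAK γ (rs γ<β) e) ,
      (λ {m} d → let c , e = proj₂ (Sim-+ᶠ (ω* γ) m (Sim-ω*-lower β m γ<β h)) d in
                 c , Sim-ω*⇒simAK γ (rs γ<β) e)

  SimAK⇒Sim : ∀ α {n} {a b : Vec Carrier n} → SimAK A α a b → Sim A α a b
  SimAK⇒Sim α = simAK⇒sim α _ _ _ _

  Sim-ω*⇒SimAK : ∀ β {n} {a b : Vec Carrier n} → Sim A (ω* β) a b → SimAK A β a b
  Sim-ω*⇒SimAK β = Sim-ω*⇒simAK β _

-- Automorphisms and infinitary formulas

  module _ (g : Automorphism A) where
    open Automorphism g

    mutual
      eval-map : ∀ {n} (a : Vec Carrier n) t → eval A (map to a) t ≡ to (eval A a t)
      eval-map a (var i)    = lookup-map i to a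
      eval-map a (app f ts) =
        trans (cong (Structure.fun A f) (evals-map a ts)) (sym (preserves-fun f (evals A a ts)))

      evals-map : ∀ {n k} (a : Vec Carrier n) (ts : Vec (Term L n) k) →
                  evals A (map to a) ts ≡ map to (evals A a ts)
      evals-map a []       = refl
      evals-map a (t ∷ ts) = cong₂ _∷_ (eval-map a t) (evals-map a ts)

    to-injective : ∀ {x y} → to x ≡ to y → x ≡ y
    to-injective {x} {y} p = trans (sym (Inverse.strictlyInverseʳ bijection x))
      (trans (cong (Inverse.from bijection) p) (Inverse.strictlyInverseʳ bijection y))

    SatAtomic-map : ∀ {n} (a : Vec Carrier n) φ → SatAtomic A φ a ⇔ SatAtomic A φ (map to a)
    SatAtomic-map a (s ≐ t) = mk⇔
      (λ p → trans (eval-map a s) (trans (cong to p) (sym (eval-map a t))))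
      (λ p → to-injective (trans (sym (eval-map a s)) (trans p (eval-map a t))))
    SatAtomic-map a (rel R ts) = subst (λ bs → _ ⇔ Structure.rel A R bs)
      (sym (evals-map a ts)) (preserves-rel R (evals A a ts))

    mutual
      Sat-map : ∀ {n} (a : Vec Carrier n) φ → Sat A φ a → Sat A φ (map to a)
      Sat-map a (atom φ) s       = Equivalence.to (SatAtomic-map a φ) s
      Sat-map a ⊤′       s       = s
      Sat-map a (¬′ φ)   s       = s ∘ Sat-map⁻ a φ
      Sat-map a (⋀ φ)    s       = λ i → Sat-map a (φ i) (s i)
      Sat-map a (⋁ φ)    (i , s) = i , Sat-map a (φ i) s
      Sat-map a (∀′ φ)   s       = λ y → subst (λ x → Sat A φ (x ∷ map to a))
        (Inverse.strictlyInverseˡ bijection y)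
        (Sat-map (Inverse.from bijection y ∷ a) φ (s _))
      Sat-map a (∃′ φ)   (x , s) = to x , Sat-map (x ∷ a) φ s

      Sat-map⁻ : ∀ {n} (a : Vec Carrier n) φ → Sat A φ (map to a) → Sat A φ a
      Sat-map⁻ a (atom φ) s       = Equivalence.from (SatAtomic-map a φ) s
      Sat-map⁻ a ⊤′       s       = s
      Sat-map⁻ a (¬′ φ)   s       = s ∘ Sat-map a φ
      Sat-map⁻ a (⋀ φ)    s       = λ i → Sat-map⁻ a (φ i) (s i)
      Sat-map⁻ a (⋁ φ)    (i , s) = i , Sat-map⁻ a (φ i) s
      Sat-map⁻ a (∀′ φ)   s       = λ x → Sat-map⁻ (x ∷ a) φ (s (to x))
      Sat-map⁻ a (∃′ φ)   (y , s) = Inverse.from bijection y ,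
        Sat-map⁻ (_ ∷ a) φ (subst (λ x → Sat A φ (x ∷ map to a))
          (sym (Inverse.strictlyInverseˡ bijection y)) s)

  automorphic⇒same : ∀ {n} {a b : Vec Carrier n} →
                     Automorphic A a b → SameInfinitaryFormulas A a b
  automorphic⇒same {a = a} (g , refl) φ = mk⇔ (Sat-map g a φ) (Sat-map⁻ g a φ)

  SameInfinitaryFormulas-sym : ∀ {n} {a b : Vec Carrier n} →
    SameInfinitaryFormulas A a b → SameInfinitaryFormulas A b a
  SameInfinitaryFormulas-sym h φ = mk⇔ (Equivalence.from (h φ)) (Equivalence.to (h φ))

-- Classical ordinals: linearity, least elements, division by ω.

module _ (em : ExcludedMiddle 0ℓ) where

  by-contra : {P : Set} → ¬ ¬ P → P
  by-contra {P} f with em {P}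
  ... | yes p = p
  ... | no ¬p = ⊥-elim (f ¬p)

  ≤⊎> : ∀ α β → α ≤ β ⊎ β < α
  ≤⊎> 𝟎 β = inj₁ 𝟎≤
  ≤⊎> (α +1) 𝟎 = inj₂ (+1≤ 𝟎≤)
  ≤⊎> (α +1) (β +1) with ≤⊎> α β
  ... | inj₁ p = inj₁ (+1≤ p)
  ... | inj₂ p = inj₂ (+1≤ p)
  ≤⊎> (α +1) (lim f f↑) with em {∃[ k ] α < f k}
  ... | yes (k , p) = inj₁ (≤lim k p)
  ... | no ¬p = inj₂ (+1≤ (lim≤ below))
    where
    below : ∀ k → f k ≤ α
    below k with ≤⊎> (α +1) (f k)
    ... | inj₁ p       = ⊥-elim (¬p (k , p))
    ... | inj₂ (+1≤ p) = p
  ≤⊎> (lim f f↑) β with em {∃[ k ] β < f k}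
  ... | yes (k , p) = inj₂ (≤lim k p)
  ... | no ¬p = inj₁ (lim≤ below)
    where
    below : ∀ k → f k ≤ β
    below k with ≤⊎> (f k) β
    ... | inj₁ p = p
    ... | inj₂ p = ⊥-elim (¬p (k , p))

  ≮⇒≥ : ∀ {α β} → ¬ α < β → β ≤ α
  ≮⇒≥ {α} {β} ¬p with ≤⊎> β α
  ... | inj₁ q = q
  ... | inj₂ q = ⊥-elim (¬p q)

  least : (P : Ord → Set) → ∀ {α} → P α → ∃[ β ] IsLeast P β
  least P {α} = go (<-wellFounded α)
    where
    go : ∀ {α} → Acc _<_ α → P α → ∃[ β ] IsLeast P β
    go {α} (acc rs) p with em {∃[ β ] β < α × P β}
    ... | yes (β , β<α , q) = go (rs β<α) q
    ... | no ¬q = α , p , λ β q → ≮⇒≥ λ β<α → ¬q (β , β<α , q)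

  <+ᶠ-cases : ∀ {β α} n → β < α +ᶠ n → β < α ⊎ ∃[ m ] β ≈ α +ᶠ m
  <+ᶠ-cases ℕ.zero p = inj₁ p
  <+ᶠ-cases {β} {α} (ℕ.suc n) (+1≤ p) with ≤⊎> (α +ᶠ n) β
  ... | inj₁ q = inj₂ (n , p , q)
  ... | inj₂ q = <+ᶠ-cases n q

  -- Either `β` falls into the topmost copy of `ω`, where the remainder is read off, or it lies
  -- below that copy and the search continues there.
  <ω*-division : ∀ {β} α → β < ω* α → ∃[ γ ] ∃[ n ] γ < α × β ≈ ω* γ +ᶠ n
  <ω*-division (α +1) (≤lim n p) with <+ᶠ-cases n p
  ... | inj₂ (m , q) = α , m , ≤-refl , q
  ... | inj₁ q = let γ , m , γ<α , r = <ω*-division α q in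
                 γ , m , ≤-trans γ<α (≤+1 α) , r
  <ω*-division (lim f f↑) (≤lim k p) =
    let γ , m , γ<fk , r = <ω*-division (f k) p in γ , m , ≤lim k γ<fk , r

  -- On a total relation a strictly increasing rank also reflects the order and is injective, so one
  -- direction is all that has to be checked.
  mkOrderType : ∀ {D _≺_ α} (rank : ℕ → Ord) →
    (∀ {x} → T (D x) → rank x < α) →
    (∀ {x y} → T (D x) → T (D y) → T (x ≺ y) → rank x < rank y) →
    (∀ {x y} → T (D x) → T (D y) → x ≢ y → T (x ≺ y) ⊎ T (y ≺ x)) →
    (∀ β → β < α → ∃[ x ] T (D x) × rank x ≈ β) →
    HasOrderType D _≺_ α
  mkOrderType {D} {_≺_} rank bounded ≺⇒< total surjective = record
    { rank = rank ; bounded = bounded ; surjective = surjective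
    ; order = λ dx dy → mk⇔ (≺⇒< dx dy) (<⇒≺ dx dy)
    ; injective = injective }
    where
    <⇒≺ : ∀ {x y} → T (D x) → T (D y) → rank x < rank y → T (x ≺ y)
    <⇒≺ {x} {y} dx dy p with x ℕ.≟ y
    ... | yes refl = ⊥-elim (<-irrefl p)
    ... | no x≢y with total dx dy x≢y
    ...   | inj₁ q = q
    ...   | inj₂ q = ⊥-elim (≤⇒≯ (<⇒≤ p) (≺⇒< dy dx q))

    injective : ∀ {x y} → T (D x) → T (D y) → rank x ≈ rank y → x ≡ y
    injective {x} {y} dx dy (p , q) with x ℕ.≟ y
    ... | yes x≡y = x≡y
    ... | no x≢y with total dx dy x≢y
    ...   | inj₁ r = ⊥-elim (≤⇒≯ q (≺⇒< dx dy r))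
    ...   | inj₂ r = ⊥-elim (≤⇒≯ p (≺⇒< dy dx r))

  module OrderType {D _≺_ α} (o : HasOrderType D _≺_ α) where
    open HasOrderType o public

    ≺⇒< : ∀ {x y} → T (D x) → T (D y) → T (x ≺ y) → rank x < rank y
    ≺⇒< dx dy = Equivalence.to (order dx dy)

    <⇒≺ : ∀ {x y} → T (D x) → T (D y) → rank x < rank y → T (x ≺ y)
    <⇒≺ dx dy = Equivalence.from (order dx dy)

    total : ∀ {x y} → T (D x) → T (D y) → x ≢ y → T (x ≺ y) ⊎ T (y ≺ x)
    total {x} {y} dx dy x≢y with ≤⊎> (rank x) (rank y) | ≤⊎> (rank y) (rank x)
    ... | inj₂ p | _      = inj₂ (<⇒≺ dy dx p)
    ... | inj₁ _ | inj₂ q = inj₁ (<⇒≺ dx dy q)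
    ... | inj₁ p | inj₁ q = ⊥-elim (x≢y (injective dx dy (p , q)))

  -- Closure properties of the computable ordinals.

  module _ {X : ℕ → Bool} where

    -- For `β < α` the order is cut at the element `x₀` of rank `β`, which enters the code as a
    -- constant. The test of `D` stays, since `_≺_` is arbitrary off `D`.
    ≤-computable : ∀ {α β} → β ≤ α → ComputableOrdinal X α → ComputableOrdinal X β
    ≤-computable {α} {β} β≤α C@(D , _≺_ , _ , _ , o) with ≤⊎> α β
    ... | inj₁ α≤β = computableOrdinal X {D} {_≺_} (computableOrder X C) record
      { rank = rank ; order = order ; injective = injective
      ; bounded = λ dx → ≤-trans (bounded dx) α≤β
      ; surjective = λ γ γ<β → surjective γ (≤-trans γ<β β≤α) }
      where open OrderType o
    ... | inj₂ β<α = computableOrdinal X {D′} {_≺_}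
      (if-decides X (proj₁ co)
         (comp₂ X {F = λ xs → bit (lookup xs Fin.zero ≺ lookup xs (Fin.suc Fin.zero))}
            (proj₂ co) (argument X Fin.zero) (const X x₀))
         (const X 0) , proj₂ co)
      record
      { rank = rank
      ; order = λ p q → order (D′⇒D p) (D′⇒D q)
      ; injective = λ p q → injective (D′⇒D p) (D′⇒D q)
      ; bounded = λ p → ≤-trans (≺⇒< (D′⇒D p) dx₀ (D′⇒≺ p)) (proj₁ rx₀)
      ; surjective = λ γ γ<β →
          let x , dx , r = surjective γ (≤-trans γ<β β≤α) in
          x , mkD′ dx (<⇒≺ dx dx₀ (≤-trans (+1≤ (proj₁ r)) (≤-trans γ<β (proj₂ rx₀)))) , r }
      where
      open OrderType o
      co = computableOrder X C
      x₀ = proj₁ (surjective β β<α)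
      dx₀ = proj₁ (proj₂ (surjective β β<α))
      rx₀ = proj₂ (proj₂ (surjective β β<α))

      D′ : ℕ → Bool
      D′ x = if D x then x ≺ x₀ else false

      D′⇒D : ∀ {x} → T (D′ x) → T (D x)
      D′⇒D {x} p with D x
      ... | true = _

      D′⇒≺ : ∀ {x} → T (D′ x) → T (x ≺ x₀)
      D′⇒≺ {x} p with D x
      ... | true = p

      mkD′ : ∀ {x} → T (D x) → T (x ≺ x₀) → T (D′ x)
      mkD′ {x} p q with D x
      ... | true = q

    -- 0 becomes the top element, above a copy of the order on the positive numbers.
    +1-computable : ∀ {α} → ComputableOrdinal X α → ComputableOrdinal X (α +1)
    +1-computable {α} C@(D , _≺_ , _ , _ , o) = computableOrdinal X {D′} {_≺′_}
      ( if-decides X (0<-decides X x)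
          (comp₁ X {F = λ xs → bit (D (lookup xs Fin.zero))} (proj₁ co) (pred-computes X x))
          (const X 1)
      , if-decides X (0<-decides X y)
          (if-decides X (0<-decides X x)
            (comp₂ X {F = λ xs → bit (lookup xs Fin.zero ≺ lookup xs (Fin.suc Fin.zero))}
              (proj₂ co) (pred-computes X x) (pred-computes X y))
            (const X 0))
          (0<-decides X x))
      (mkOrderType rank′
        (λ {x} → bounded′ {x}) (λ {x} {y} → ≺′⇒< {x} {y}) (λ {x} {y} → total′ {x} {y})
        surjective′)
      where
      open OrderType o
      co = computableOrder X C
      x : ∀ {n} → Computes X (ℕ.suc n) (λ xs → lookup xs Fin.zero)
      x = argument X Fin.zero
      y = argument X {2} (Fin.suc Fin.zero)

      D′ : ℕ → Bool
      D′ x = if 0 ℕ.<ᵇ x then D (ℕ.pred x) else true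

      _≺′_ : ℕ → ℕ → Bool
      x ≺′ y = if 0 ℕ.<ᵇ y then (if 0 ℕ.<ᵇ x then ℕ.pred x ≺ ℕ.pred y else false)
               else 0 ℕ.<ᵇ x

      rank′ : ℕ → Ord
      rank′ ℕ.zero    = α
      rank′ (ℕ.suc x) = rank x

      bounded′ : ∀ {x} → T (D′ x) → rank′ x < α +1
      bounded′ {ℕ.zero}  _  = ≤-refl
      bounded′ {ℕ.suc x} dx = ≤-trans (bounded dx) (≤+1 α)

      ≺′⇒< : ∀ {x y} → T (D′ x) → T (D′ y) → T (x ≺′ y) → rank′ x < rank′ y
      ≺′⇒< {ℕ.suc x} {ℕ.suc y} dx dy p = ≺⇒< dx dy p
      ≺′⇒< {ℕ.suc x} {ℕ.zero}  dx dy p = bounded dx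

      total′ : ∀ {x y} → T (D′ x) → T (D′ y) → x ≢ y → T (x ≺′ y) ⊎ T (y ≺′ x)
      total′ {ℕ.zero}  {ℕ.zero}  _  _  x≢y = ⊥-elim (x≢y refl)
      total′ {ℕ.zero}  {ℕ.suc y} _  _  _   = inj₂ _
      total′ {ℕ.suc x} {ℕ.zero}  _  _  _   = inj₁ _
      total′ {ℕ.suc x} {ℕ.suc y} dx dy x≢y = total dx dy (x≢y ∘ cong ℕ.suc)

      surjective′ : ∀ β → β < α +1 → ∃[ x ] T (D′ x) × rank′ x ≈ β
      surjective′ β (+1≤ β≤α) with ≤⊎> α β
      ... | inj₁ α≤β = 0 , _ , α≤β , β≤α
      ... | inj₂ β<α = let x , r = surjective β β<α in ℕ.suc x , r

    -- Each x in D is replaced by its fibre, an infinite set ordered as in ℕ.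
    ω*-computable : ∀ {α} → ComputableOrdinal X α → ComputableOrdinal X (ω* α)
    ω*-computable {α} C@(D , _≺_ , _ , _ , o) = computableOrdinal X {D′} {_≺′_}
      ( comp₁ X {F = λ xs → bit (D (lookup xs Fin.zero))} (proj₁ co) (fibre-computes X x)
      , if-decides X (≺-decides x y) (const X 1)
          (if-decides X (≺-decides y x) (const X 0)
            (0<-decides X (∸-computes X y x))))
      (mkOrderType rank′
        (λ {z} dz → <⇒ω*< z (bounded dz))
        (λ {z} {w} → ≺′⇒< {z} {w}) (λ {z} {w} → total′ {z} {w})
        surjective′)
      where
      open OrderType o
      co = computableOrder X C
      x : ∀ {n} → Computes X (ℕ.suc n) (λ xs → lookup xs Fin.zero)
      x = argument X Fin.zero
      y = argument X {2} (Fin.suc Fin.zero)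
      ≺-decides : ∀ {f g : Vec ℕ 2 → ℕ} → Computes X 2 f → Computes X 2 g →
                  Decides X 2 (λ xs → fibre (f xs) ≺ fibre (g xs))
      ≺-decides f g =
        comp₂ X {F = λ xs → bit (lookup xs Fin.zero ≺ lookup xs (Fin.suc Fin.zero))}
          (proj₂ co) (fibre-computes X f) (fibre-computes X g)

      D′ : ℕ → Bool
      D′ z = D (fibre z)

      -- Lexicographic order. Equality of fibres needs no test: members of `D` that are unrelated in
      -- both directions are equal.
      _≺′_ : ℕ → ℕ → Bool
      z ≺′ w = if fibre z ≺ fibre w then true else
               (if fibre w ≺ fibre z then false else (0 ℕ.<ᵇ (w ∸ z)))

      rank′ : ℕ → Ord
      rank′ z = ω* rank (fibre z) +ᶠ position z

      <⇒ω*< : ∀ z {β} → rank (fibre z) < β → rank′ z < ω* β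
      <⇒ω*< z p = ω*+ᶠ<ω* (position z) p

      ≺⇒rank′< : ∀ {z w} → T (D′ z) → T (D′ w) → T (fibre z ≺ fibre w) → rank′ z < rank′ w
      ≺⇒rank′< {z} {w} dz dw p = ≤-trans (<⇒ω*< z (≺⇒< dz dw p)) (≤+ᶠ _ (position w))

      ≺′⇒< : ∀ {z w} → T (D′ z) → T (D′ w) → T (z ≺′ w) → rank′ z < rank′ w
      ≺′⇒< {z} {w} dz dw p
        -- `total` is abstracted together with both comparisons; when these are false it refutes
        -- distinct fibres.
        with fibre z ≺ fibre w | ≺⇒rank′< {z} {w} dz dw | fibre w ≺ fibre z | <⇒≺ dw dz | total dz dw
      ... | true  | q | _     | _ | _ = q _
      ... | false | _ | false | r | t with fibre z ℕ.≟ fibre w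
      ...   | no z≢w with t z≢w
      ...     | inj₁ ()
      ...     | inj₂ ()
      ≺′⇒< {z} {w} dz dw p | false | _ | false | r | t | yes z≡w =
        subst (λ x → rank′ z < ω* rank x +ᶠ position w) z≡w
          (+ᶠ-monoʳ (ω* rank (fibre z)) (position-mono z w z≡w (0<ᵇ∸⇒< {z} p)))

      total′ : ∀ {z w} → T (D′ z) → T (D′ w) → z ≢ w → T (z ≺′ w) ⊎ T (w ≺′ z)
      total′ {z} {w} dz dw z≢w with fibre z ≺ fibre w | fibre w ≺ fibre z
      ... | true  | _     = inj₁ _
      ... | false | true  = inj₂ _
      ... | false | false with ℕₚ.<-cmp z w
      ...   | tri< p _ _ = inj₁ (<⇒0<ᵇ∸ p)
      ...   | tri≈ _ p _ = ⊥-elim (z≢w p)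
      ...   | tri> _ _ p = inj₂ (<⇒0<ᵇ∸ p)

      surjective′ : ∀ β → β < ω* α → ∃[ z ] T (D′ z) × rank′ z ≈ β
      -- The quotient selects the fibre, the remainder the position in it.
      surjective′ β β<ω*α with <ω*-division α β<ω*α
      ... | γ , n , γ<α , β≤ , ≤β with surjective γ γ<α
      ...   | x , dx , r with position-surjective x n
      ...     | z , refl , refl = z , dx ,
        ≤-trans (+ᶠ-monoˡ n (ω*-mono (proj₁ r))) ≤β ,
        ≤-trans β≤ (+ᶠ-monoˡ n (ω*-mono (proj₂ r)))

-- Scott's isomorphism theorem, and the two ranks

  module _ {L : Vocabulary} (A : Structure L) where
    open Structure A using (Carrier; countable)
    open Injection countable using () renaming (to to code; injective to code-injective)

    -- An enumeration with gaps, which also covers finite and empty carriers.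
    decode : ℕ → Maybe Carrier
    decode n with em {∃[ x ] code x ≡ n}
    ... | yes (x , _) = just x
    ... | no _        = nothing

    decode-code : ∀ x → decode (code x) ≡ just x
    decode-code x with em {∃[ y ] code y ≡ code x}
    ... | yes (y , p) = cong just (code-injective p)
    ... | no ¬p       = ⊥-elim (¬p (x , refl))

    -- A formula that separates the tuples the wrong way round is replaced by its negation.
    distinguish : ∀ {n} {a b : Vec Carrier n} → ¬ SameInfinitaryFormulas A a b →
                  ∃[ φ ] Sat A φ a × ¬ Sat A φ b
    distinguish ¬same = by-contra λ none → ¬same λ φ → mk⇔
      (λ s → by-contra λ ¬t → none (φ , s , ¬t))
      (λ t → by-contra λ ¬s → none (¬′ φ , ¬s , λ ¬t → ¬t t))

    -- Otherwise each d is separated from c by a formula, and the conjunction of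
    -- these countably many formulas, satisfied by c, is satisfied by no d.
    same-forth : ∀ {n} {a b : Vec Carrier n} → SameInfinitaryFormulas A a b →
                 ∀ c → ∃[ d ] SameInfinitaryFormulas A (c ∷ a) (d ∷ b)
    same-forth {n} {a} {b} same c = by-contra λ none →
      let separate = λ d → distinguish (λ s → none (d , s))
          φ : Maybe Carrier → Infinitary L (ℕ.suc n)
          φ = maybe (proj₁ ∘ separate) ⊤′
          φ-c : ∀ m → Sat A (φ m) (c ∷ a)
          φ-c = maybe (λ d → proj₁ (proj₂ (separate d))) _
          d , φ-d = Equivalence.to (same (∃′ (⋀ (φ ∘ decode)))) (c , φ-c ∘ decode)
      in proj₂ (proj₂ (separate d))
           (subst (λ m → Sat A (φ m) (d ∷ b)) (decode-code d) (φ-d (code d)))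

    -- A finite piece of the future automorphism. Entries may repeat; equality atoms still make the
    -- pairing single-valued and injective.
    record Stage : Set where
      constructor stage
      field
        {size} : ℕ
        left right : Vec Carrier size
        same       : SameInfinitaryFormulas A left right
    open Stage

    _∋_↦_ : Stage → Carrier → Carrier → Set
    s ∋ x ↦ y = ∃[ i ] lookup (left s) i ≡ x × lookup (right s) i ≡ y

    -- One forth and one back move for the same element: `x` is sent to `d`, and `c` is sent to `x`.
    extend : Stage → Carrier → Stage
    extend (stage a b same) x =
      let d , same′ = same-forth same x
          c , same″ = same-forth (SameInfinitaryFormulas-sym A same′) x
      in stage (c ∷ x ∷ a) (x ∷ d ∷ b) (SameInfinitaryFormulas-sym A same″)

    ↦-unique : ∀ s {x y x′ y′} → s ∋ x ↦ y → s ∋ x′ ↦ y′ → x ≡ x′ ⇔ y ≡ y′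
    ↦-unique s (i , refl , refl) (j , refl , refl) = same s (atom (var i ≐ var j))

    grow : Stage → Maybe Carrier → Stage
    grow s (just x) = extend s x
    grow s nothing  = s

    grow-mono : ∀ s m {x y} → s ∋ x ↦ y → grow s m ∋ x ↦ y
    grow-mono s (just _) (i , p) = Fin.suc (Fin.suc i) , p
    grow-mono s nothing  p       = p

    grow-image : ∀ s {m x} → m ≡ just x → ∃[ y ] grow s m ∋ x ↦ y
    grow-image s refl = _ , Fin.suc Fin.zero , refl , refl

    grow-preimage : ∀ s {m y} → m ≡ just y → ∃[ x ] grow s m ∋ x ↦ y
    grow-preimage s refl = _ , Fin.zero , refl , refl

    module _ (s₀ : Stage) where

      stages : ℕ → Stage
      stages ℕ.zero    = s₀
      stages (ℕ.suc n) = grow (stages n) (decode n)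

      stages-mono : ∀ {m n x y} → m ℕ.≤′ n → stages m ∋ x ↦ y → stages n ∋ x ↦ y
      stages-mono ℕ.≤′-refl         p = p
      stages-mono (ℕ.≤′-step {n} q) p = grow-mono (stages n) (decode n) (stages-mono q p)

      image : ∀ x → ∃[ y ] stages (ℕ.suc (code x)) ∋ x ↦ y
      image x = grow-image (stages (code x)) (decode-code x)

      preimage : ∀ y → ∃[ x ] stages (ℕ.suc (code y)) ∋ x ↦ y
      preimage y = grow-preimage (stages (code y)) (decode-code y)

      g h : Carrier → Carrier
      g = proj₁ ∘ image
      h = proj₁ ∘ preimage

      stages-unique : ∀ {m n x y x′ y′} → stages m ∋ x ↦ y → stages n ∋ x′ ↦ y′ → x ≡ x′ ⇔ y ≡ y′
      stages-unique {m} {n} p q = ↦-unique (stages (m ℕ.⊔ n))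
        (stages-mono (ℕₚ.≤⇒≤′ (ℕₚ.m≤m⊔n m n)) p)
        (stages-mono (ℕₚ.≤⇒≤′ (ℕₚ.m≤n⊔m m n)) q)

      g-unique : ∀ {n x y} → stages n ∋ x ↦ y → g x ≡ y
      g-unique {n} {x} p = Equivalence.to (stages-unique {ℕ.suc (code x)} {n} (proj₂ (image x)) p) refl

      h-unique : ∀ {n x y} → stages n ∋ x ↦ y → h y ≡ x
      h-unique {n} {y = y} p =
        Equivalence.from (stages-unique {ℕ.suc (code y)} {n} (proj₂ (preimage y)) p) refl

      -- The same variables name a tuple on the left and its image on the right, so preservation by
      -- `g` reduces to one atomic formula at one stage. Quantifying over all later `m` allows the
      -- bounds of several entries to be joined.
      name : ∀ {k} (as : Vec Carrier k) → ∃[ n ] ∀ {m} → n ℕ.≤ m →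
        Σ (Vec (Term L (size (stages m))) k) λ ts →
          evals A (left (stages m)) ts ≡ as × evals A (right (stages m)) ts ≡ map g as
      name []       = 0 , λ _ → [] , refl , refl
      name (x ∷ as) = let n , f = name as in ℕ.suc (code x) ℕ.⊔ n , λ l →
        let ts , p , q = f (ℕₚ.m⊔n≤o⇒n≤o (ℕ.suc (code x)) n l)
            i , r , s  = stages-mono (ℕₚ.≤⇒≤′ (ℕₚ.m⊔n≤o⇒m≤o (ℕ.suc (code x)) n l)) (proj₂ (image x))
        in var i ∷ ts , cong₂ _∷_ r p , cong₂ _∷_ s q

      g-automorphism : Automorphism A
      g-automorphism = record
        { bijection = mk↔ₛ′ g h
            (λ y → g-unique {ℕ.suc (code y)} (proj₂ (preimage y)))
            (λ x → h-unique {ℕ.suc (code x)} (proj₂ (image x)))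
        ; preserves-rel = preserves-rel
        ; preserves-fun = preserves-fun }
        where
        preserves-rel : ∀ R as → Structure.rel A R as ⇔ Structure.rel A R (map g as)
        preserves-rel R as =
          let n , f = name as
              ts , p , q = f ℕₚ.≤-refl
          in subst₂ (λ as bs → Structure.rel A R as ⇔ Structure.rel A R bs) p q
               (same (stages n) (atom (rel R ts)))

        preserves-fun : ∀ f as → g (Structure.fun A f as) ≡ Structure.fun A f (map g as)
        -- The value is named along with its arguments, so that the equation `t ≐ app f ts` can be
        -- transferred.
        preserves-fun f as with name (Structure.fun A f as ∷ as)
        ... | n , name-n with name-n ℕₚ.≤-refl
        ...   | t ∷ ts , p , q with ∷-injective p | ∷-injective q
        ...     | p₀ , p₁ | q₀ , q₁ = trans (sym q₀) (trans
                  (Equivalence.to (same (stages n) (atom (t ≐ app f ts)))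
                    (trans p₀ (cong (Structure.fun A f) (sym p₁))))
                  (cong (Structure.fun A f) q₁))

    same⇒automorphic : ∀ {n} {a b : Vec Carrier n} →
                       SameInfinitaryFormulas A a b → Automorphic A a b
    same⇒automorphic {a = a} {b} s = g-automorphism s₀ , (begin
      map (g s₀) a                     ≡⟨ tabulate∘lookup _ ⟨
      tabulate (lookup (map (g s₀) a)) ≡⟨ tabulate-cong (λ i → trans (lookup-map i (g s₀) a)
                                            -- The initial stage already pairs the entries of `a`
                                            -- with those of `b`.
                                            (g-unique s₀ {0} (i , refl , refl))) ⟩
      tabulate (lookup b)              ≡⟨ tabulate∘lookup b ⟩
      b                                ∎)
      where
      open ≡-Reasoning
      s₀ = stage a b s

    -- Comparison of the two ranks and of their suprema.

    RankAK Rank∼ : ∀ {n} → Vec Carrier n → Ord → Set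
    RankAK = IsRank A (SimAK A) (SameInfinitaryFormulas A)
    Rank∼  = IsRank A (Sim A) (Automorphic A)

    rank-exists : (E : Ord → TupleRel A) (S : TupleRel A) → ∀ {n} {a : Vec Carrier n} {ρ} →
                  (∀ b → E ρ a b → S a b) → ∃[ ρ′ ] IsRank A E S a ρ′ × ρ′ ≤ ρ
    rank-exists E S {a = a} {ρ} p =
      let ρ′ , l = least (λ ρ → ∀ b → E ρ a b → S a b) p in ρ′ , l , proj₂ l ρ p

    Rank∼⇒RankAK : ∀ {n} {a : Vec Carrier n} {ρ} → Rank∼ a ρ → ∃[ ρ′ ] RankAK a ρ′ × ρ′ ≤ ρ
    Rank∼⇒RankAK {ρ = ρ} (p , _) = rank-exists (SimAK A) (SameInfinitaryFormulas A)
      λ b s → automorphic⇒same A (p b (SimAK⇒Sim A ρ s))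

    RankAK⇒Rank∼ : ∀ {n} {a : Vec Carrier n} {ρ} → RankAK a ρ → ∃[ ρ′ ] Rank∼ a ρ′ × ρ′ ≤ ω* ρ
    RankAK⇒Rank∼ {ρ = ρ} (p , _) = rank-exists (Sim A) (Automorphic A)
      λ b s → same⇒automorphic (p b (Sim-ω*⇒SimAK A ρ s))

    BoundsAK Bounds∼ : Ord → Set
    BoundsAK σ = ∀ {n} {a : Vec Carrier n} {ρ} → RankAK a ρ → ρ < σ
    Bounds∼  σ = ∀ {n} {a : Vec Carrier n} {ρ} → Rank∼ a ρ → ρ < σ

    -- The bound applies to the ∼-rank obtained from `r`. Passing back yields an Ash-Knight rank
    -- below that one, and minimality of the given rank closes the circle.
    Bounds∼⇒BoundsAK : ∀ {σ} → Bounds∼ σ → BoundsAK σ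
    Bounds∼⇒BoundsAK bound r =
      let ρ∼ , r∼ , _ = RankAK⇒Rank∼ r
          ρ′ , r′ , ρ′≤ρ∼ = Rank∼⇒RankAK r∼
      in ≤-trans (+1≤ (≤-trans (proj₂ r ρ′ (proj₁ r′)) ρ′≤ρ∼)) (bound r∼)

    BoundsAK⇒Bounds∼ : ∀ {σ τ} → (∀ {ρ} → ρ < σ → ω* ρ < τ) → BoundsAK σ → Bounds∼ τ
    BoundsAK⇒Bounds∼ {τ = τ} closed bound r =
      let ρ , rAK , _ = Rank∼⇒RankAK r
          ρ∼ , r∼ , ρ∼≤ = RankAK⇒Rank∼ rAK
      in ≤-trans (+1≤ (≤-trans (proj₂ r ρ∼ (proj₁ r∼)) ρ∼≤)) (closed (bound rAK))

    IsSup⇔IsLeast : (E : Ord → TupleRel A) (S : TupleRel A) (σ : Ord) →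
      IsSupRank A E S σ ⇔ IsLeast (λ τ → ∀ {n} {a : Vec Carrier n} {ρ} → IsRank A E S a ρ → ρ < τ) σ
    IsSup⇔IsLeast E S σ = mk⇔
      (λ (p , q) → to p , λ τ b → q τ (from b))
      (λ (p , q) → from p , λ τ b → q τ (to b))
      where
      to : ∀ {τ} → (∀ α → (∃[ n ] Σ (Vec Carrier n) λ a → ∃[ ρ ] IsRank A E S a ρ × α ≡ ρ +1) → α ≤ τ) →
           ∀ {n} {a : Vec Carrier n} {ρ} → IsRank A E S a ρ → ρ < τ
      to p r = p _ (_ , _ , _ , r , refl)
      from : ∀ {τ} → (∀ {n} {a : Vec Carrier n} {ρ} → IsRank A E S a ρ → ρ < τ) →
             ∀ α → (∃[ n ] Σ (Vec Carrier n) λ a → ∃[ ρ ] IsRank A E S a ρ × α ≡ ρ +1) → α ≤ τ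
      from p _ (_ , _ , _ , r , refl) = p r

    module _ {κ : Ord} (ω*-closed : ∀ {α} → α < κ → ω* α < κ) (ω*κ≤κ : ω* κ ≤ κ) where

      BoundsAK⇒Bounds∼-below : ∀ {σ} → σ < κ → BoundsAK σ → ∃[ τ ] τ < κ × Bounds∼ τ
      BoundsAK⇒Bounds∼-below {σ} σ<κ b = ω* σ , ω*-closed σ<κ , BoundsAK⇒Bounds∼ (ω*+ᶠ<ω* 0) b

      -- Below `κ +1` the only new rank is `κ` itself, which `ω*κ≤κ` handles.
      ω*-closed-≈ : ∀ {v} → v ≈ κ ⊎ v ≈ κ +1 → ∀ {ρ} → ρ < v → ω* ρ < v
      ω*-closed-≈ (inj₁ (v≤κ , κ≤v)) ρ<v = ≤-trans (ω*-closed (≤-trans ρ<v v≤κ)) κ≤v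
      ω*-closed-≈ (inj₂ (v≤κ+1 , κ+1≤v)) ρ<v with ≤-trans ρ<v v≤κ+1
      ... | +1≤ ρ≤κ = ≤-trans (+1≤ (≤-trans (ω*-mono ρ≤κ) ω*κ≤κ)) κ+1≤v

      SRAK⇔SR∼ : ∀ v → v ≈ κ ⊎ v ≈ κ +1 → IsLeast BoundsAK v ⇔ IsLeast Bounds∼ v
      SRAK⇔SR∼ v v≈ = mk⇔
        (λ (b , l) → BoundsAK⇒Bounds∼ (ω*-closed-≈ v≈) b , λ τ b∼ → l τ (Bounds∼⇒BoundsAK b∼))
        (λ (b , l) → Bounds∼⇒BoundsAK b , λ τ bAK → ≮⇒≥ λ τ<v → lower v≈ l bAK τ<v)
        where
        -- A smaller Ash-Knight bound `τ` would give a ∼-bound below `v`: for `v ≈ κ` it is `ω* τ`,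
        -- for `v ≈ κ +1` it is `κ`, as `ω* ρ < κ` whenever `ρ < τ ≤ κ`.
        lower : v ≈ κ ⊎ v ≈ κ +1 → (∀ τ → Bounds∼ τ → v ≤ τ) → ∀ {τ} → BoundsAK τ → ¬ τ < v
        lower (inj₁ (v≤κ , κ≤v)) l bAK τ<v =
          let τ′ , τ′<κ , b = BoundsAK⇒Bounds∼-below (≤-trans τ<v v≤κ) bAK in
          ≤⇒≯ (l τ′ b) (≤-trans τ′<κ κ≤v)
        lower (inj₂ (v≤κ+1 , κ+1≤v)) l bAK τ<v with ≤-trans τ<v v≤κ+1
        ... | +1≤ τ≤κ = ≤⇒≯
          (l κ (BoundsAK⇒Bounds∼ (λ ρ<τ → ω*-closed (≤-trans ρ<τ τ≤κ)) bAK)) κ+1≤v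

      ≥SRAK⇔≥SR∼ : (∃[ σ ] IsLeast BoundsAK σ × κ ≤ σ) ⇔ (∃[ σ ] IsLeast Bounds∼ σ × κ ≤ σ)
      ≥SRAK⇔≥SR∼ = mk⇔ forth back
        where
        forth : (∃[ σ ] IsLeast BoundsAK σ × κ ≤ σ) → ∃[ σ ] IsLeast Bounds∼ σ × κ ≤ σ
        forth (σ , (b , l) , κ≤σ) =
          -- `ω* σ` bounds the ∼-ranks, so their supremum exists.
          let τ , b∼ , l∼ = least Bounds∼ (λ {n} {a} {ρ} → BoundsAK⇒Bounds∼ (ω*+ᶠ<ω* 0) b {n} {a} {ρ}) in
          τ , (b∼ , l∼) , ≤-trans κ≤σ (l τ (Bounds∼⇒BoundsAK b∼))

        back : (∃[ σ ] IsLeast Bounds∼ σ × κ ≤ σ) → ∃[ σ ] IsLeast BoundsAK σ × κ ≤ σ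
        back (σ , (b , l) , κ≤σ) =
          let τ , bAK , lAK = least BoundsAK (λ {n} {a} {ρ} → Bounds∼⇒BoundsAK b {n} {a} {ρ}) in
          τ , (bAK , lAK) , ≮⇒≥ λ τ<κ →
            let τ′ , τ′<κ , b∼ = BoundsAK⇒Bounds∼-below τ<κ bAK in
            ≤⇒≯ (≤-trans κ≤σ (l τ′ b∼)) τ′<κ

  -- Closure properties of ω₁ relative to an oracle.

  module _ {X : ℕ → Bool} {κ : Ord} (κ-least : IsOmega₁-oracle X κ) where

    computable⇒<ω₁ : ∀ {α} → ComputableOrdinal X α → α < κ
    computable⇒<ω₁ {α} c with ≤⊎> κ α
    ... | inj₁ κ≤α = ⊥-elim (proj₁ κ-least (≤-computable κ≤α c))
    ... | inj₂ α<κ = α<κ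

    <ω₁⇒computable : ∀ {α} → α < κ → ComputableOrdinal X α
    <ω₁⇒computable α<κ = by-contra λ ¬c → ≤⇒≯ (proj₂ κ-least _ ¬c) α<κ

    ω*<ω₁ : ∀ {α} → α < κ → ω* α < κ
    ω*<ω₁ = computable⇒<ω₁ ∘ ω*-computable ∘ <ω₁⇒computable

    +1<ω₁ : ∀ {α} → α < κ → α +1 < κ
    +1<ω₁ = computable⇒<ω₁ ∘ +1-computable ∘ <ω₁⇒computable

  -- Closure under successor rules out the successor case. At a limit, `ω* κ` is the supremum of the
  -- products `ω* f k`, all of which stay below `κ`.
  ω*ω₁≤ω₁ : ∀ {X} κ → IsOmega₁-oracle X κ → ω* κ ≤ κ
  ω*ω₁≤ω₁ 𝟎          _ = 𝟎≤
  ω*ω₁≤ω₁ (κ +1)     l = ⊥-elim (<-irrefl (+1<ω₁ l ≤-refl))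
  ω*ω₁≤ω₁ (lim f f↑) l = lim≤ λ k → <⇒≤ (ω*<ω₁ l (≤lim (ℕ.suc k) (f↑ k)))

mainTheorem14 : ExcludedMiddle 0ℓ →
    (L : Vocabulary) (A : Structure L) (κ : Ord) → IsOmega₁ A κ →
    (∀ v → v ≈ κ ⊎ v ≈ κ +1 → IsSRAK A v ⇔ IsSR∼ A v) ×
    ((∃[ σ ] (IsSRAK A σ × κ ≤ σ)) ⇔ (∃[ σ ] (IsSR∼ A σ × κ ≤ σ)))
mainTheorem14 em L A κ ((X , _ , κ-least) , _) =
  (λ v v≈ → ⇔-sym (SR∼ v) ⇔-∘ (SRAK⇔SR∼ em A ω*< ω*≤ v v≈ ⇔-∘ SRAK v)) ,
  (⇔-sym (≥κ SR∼) ⇔-∘ (≥SRAK⇔≥SR∼ em A ω*< ω*≤ ⇔-∘ ≥κ SRAK))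
  where
  ω*< : ∀ {α} → α < κ → ω* α < κ
  ω*< = ω*<ω₁ em κ-least
  ω*≤ = ω*ω₁≤ω₁ em κ κ-least
  SRAK = IsSup⇔IsLeast em A (SimAK A) (SameInfinitaryFormulas A)
  SR∼  = IsSup⇔IsLeast em A (Sim A) (Automorphic A)

  ≥κ : {P Q : Ord → Set} → (∀ σ → P σ ⇔ Q σ) → (∃[ σ ] P σ × κ ≤ σ) ⇔ (∃[ σ ] Q σ × κ ≤ σ)
  ≥κ f = mk⇔ (λ (σ , p , l) → σ , Equivalence.to (f σ) p , l)
             (λ (σ , q , l) → σ , Equivalence.from (f σ) q , l)
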